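{- For every integer $k \ge 3$, \[ C(\textsc{mpj}_k) ~=~ O\left( n \left(\frac{k\log\log n}{\log n}\right)^{(k-2)/(k-1)} \right). \] In particular, $C(\textsc{mpj}_3) = O\left(n\sqrt{\log\log n/\log n}\right)$.
   Context: All logarithms are base $2$; $[n]=\{1,\dots,n\}$. The Boolean pointer jumping problem $\textsc{mpj}_k$ (for $k\ge 2$) is the function $\textsc{mpj}_k:[n]\times([n]^{[n]})^{k-2}\times\{0,1\}^n\to\{0,1\}$ given by $\textsc{mpj}_k(i,f_2,\ldots,f_{k-1},x) = x_{f_{k-1}\circ\cdots\circ f_2(i)}$, where $x_r$ denotes the $r$th bit of $x$ (for $k=2$ this is $x_i$). It is viewed as a $k$-player number-on-the-forehead (NOF) communication problem: the $j$th component of the input ($i$ for $j=1$, $f_j$ for $2\le j\le k-1$, $x$ for $j=k$) is written on the forehead of player $j$, who sees every component except her own. In a (deterministic, one-way) protocol, the players each write exactly one message on a public blackboard in the fixed order player $1$, player $2$, \dots, player $k$; each player's message is a deterministic function of the input components she sees and the messages already on the blackboard, and player $k$'s message must equal the value of the function. The cost of a protocol is the total number of bits written, on a worst-case input, and $C(\textsc{mpj}_k)$ is the minimum cost of such a protocol for $\textsc{mpj}_k$. -}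

module Defs where

open import Data.Nat using (ℕ; zero; suc; _+_; _*_; _∸_; _^_; _≤_; _<_)
open import Data.Nat.Logarithm using (⌊log₂_⌋)
open import Data.Fin using (Fin; toℕ)
import Data.Fin as F
open import Data.Bool using (Bool)
open import Data.List using (List; []; _∷_; _++_; [_]; map; length)
open import Data.Nat.ListAction using (sum)
open import Data.Product using (_×_; Σ)
open import Relation.Binary.PropositionalEquality using (_≡_; _≢_)

-- An input to mpj_k (k players, n = size of the domain [n], represented by Fin n).
--   start        : the index i                (forehead of player 1, index 0 here)
--   fun l        : the function f_{l+2}, l = 0 .. k-3 (forehead of player l+2, index l+1)
--   bits         : the string x ∈ {0,1}^n     (forehead of player k, index k-1)
record Input (k n : ℕ) : Set where
  constructor input
  field
    start : Fin n
    fun   : Fin (k ∸ 2) → Fin n → Fin n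
    bits  : Fin n → Bool
open Input public

compose : ∀ {n} (m : ℕ) → (Fin m → Fin n → Fin n) → Fin n → Fin n
compose zero    fs i = i
compose (suc m) fs i = compose m (λ l → fs (F.suc l)) (fs F.zero i)

mpj : ∀ {k n} → Input k n → Bool
mpj {k} I = bits I (compose (k ∸ 2) (fun I) (start I))

-- Players are numbered 0 .. k-1 (player j+1 of the paper is index j).
-- AgreeExcept k j I I' : the inputs I and I' agree on every component except
-- (possibly) the one on the forehead of player j, i.e. player j cannot
-- distinguish them.
AgreeExcept : ∀ {n} (k j : ℕ) → Input k n → Input k n → Set
AgreeExcept k j I I' =
  (j ≢ 0 → start I ≡ start I')
  × (j ≢ k ∸ 1 → ∀ r → bits I r ≡ bits I' r)
  × (∀ l → j ≢ suc (toℕ l) → ∀ r → fun I l r ≡ fun I' l r)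

Board : Set
Board = List (List Bool)

-- A deterministic one-way NOF protocol: player j, given the whole input and
-- the current blackboard, writes a message; the view condition in
-- `Correct` below forces it to depend only on what player j sees.
Protocol : ℕ → ℕ → Set
Protocol k n = (j : ℕ) → Input k n → Board → List Bool

board : ∀ {k n} → Protocol k n → Input k n → ℕ → Board
board P I zero    = []
board P I (suc t) = board P I t ++ [ P t I (board P I t) ]

cost : ∀ {k n} → Protocol k n → Input k n → ℕ
cost {k} P I = sum (map length (board P I k))

Correct : ∀ {k n} → Protocol k n → Set
Correct {k} {n} P =
  (∀ j → j < k → ∀ (I I' : Input k n) (B : Board) →
     AgreeExcept k j I I' → P j I B ≡ P j I' B)
  × (∀ (I : Input k n) → P (k ∸ 1) I (board P I (k ∸ 1)) ≡ [ mpj I ])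

CostAtMost : ℕ → ℕ → ℕ → Set
CostAtMost k n b = Σ (Protocol k n) λ P → Correct P × (∀ I → cost P I ≤ b)

lg : ℕ → ℕ
lg n = ⌊log₂ n ⌋

lglg : ℕ → ℕ
lglg n = ⌊log₂ ⌊log₂ n ⌋ ⌋

{-# OPTIONS --safe #-}

-- A cheap protocol already results from treating mpj_k as a three-player problem: the function
-- f₂ = f in the middle, and the string y = x ∘ f_{k−1} ∘ … ∘ f₃, which players 1 and 2 both know.
-- Fix for every u a small set N(u) of positions and call u, u′ adjacent if f(u′) ∈ N(u) and
-- f(u) ∈ N(u′).  Player 1 announces the parity of y over f(C) for the cliques C of a cover,
-- player 2 announces y on N(i), and if i ∈ C these bits determine y(f(i)).  By counting, N can
-- be chosen with |N(u)| ≤ n / log n such that, whatever f is, any polylog(n) vertices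
-- with distinct images contain an adjacent pair.  Ramsey's bound then gives cliques of size
-- Ω(log n / log log n) among any n / log n vertices with distinct images, so O(n log log n / log n)
-- greedily chosen cliques leave at most n / log n images, which player 1 announces one by one.
-- The resulting cost O(n log log n / log n) is below the claimed bound.
module Submission where

open import Defs
open import Data.Nat using (ℕ; zero; suc; _+_; _*_; _∸_; _^_; _/_; _%_; _≤_; _<_; _≤?_; _≟_; z≤n; s≤s; NonZero; >-nonZero; >-nonZero⁻¹; ⌊_/2⌋; ⌈_/2⌉)
open import Data.Nat.Properties hiding (_≟_)
open import Data.Nat.DivMod using (m≡m%n+[m/n]*n; m%n<n; /-monoˡ-≤; m*n/n≡m; m/n*n≤m; m≥n⇒m/n>0)
open import Data.Nat.Logarithm using (⌊log₂_⌋; ⌊log₂⌋-mono-≤; ⌊log₂⌊n/2⌋⌋≡⌊log₂n⌋∸1; ⌊log₂[2^n]⌋≡n)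
open import Data.Nat.Induction using (<-rec)
open import Data.Nat.ListAction using (product)
import Data.Nat.ListAction as ListAction
open import Data.Nat.ListAction.Properties using (sum-++)
open import Data.Nat.Solver using (module +-*-Solver)
open import Data.Fin using (Fin; combine; remQuot)
import Data.Fin as F
open import Data.Fin.Properties using (remQuot-combine; combine-injectiveˡ; combine-injectiveʳ)
  renaming (_≟_ to _≟ᶠ_)
open import Data.Fin.Subset.Properties using (anySubset?)
open import Data.Bool using (Bool; true; false; _xor_; if_then_else_)
import Data.Bool.Properties as Bool
open import Data.List using (List; []; _∷_; [_]; _++_; map; length; filter; tabulate; allFin; foldr; partition; take)
open import Data.List.Properties using (length-++; length-map; length-tabulate; map-++; ∷-injective; ≡-dec)
open import Data.List.Membership.Propositional using (_∈_; find)
open import Data.List.Membership.Propositional.Properties using (∈-filter⁺; ∈-allFin; ∈-++⁺ˡ; ∈-++⁺ʳ; ∈-++⁻; ∈-map⁺)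
import Data.List.Membership.DecPropositional as DecMembership
open import Data.List.Relation.Unary.Any using (Any; here; there; any?)
open import Data.List.Relation.Unary.All using (All; []; _∷_)
import Data.List.Relation.Unary.All as All
import Data.List.Relation.Unary.All.Properties as All
open import Data.List.Relation.Unary.AllPairs using (AllPairs; []; _∷_; allPairs?)
import Data.List.Relation.Unary.AllPairs as AllPairs
import Data.List.Relation.Unary.AllPairs.Properties as AllPairs
open import Data.List.Relation.Binary.Permutation.Propositional using (_↭_; ↭-refl; ↭-trans; ↭-sym; ↭-prep; ↭⇒↭ₛ; ↭ₛ⇒↭)
open import Data.List.Relation.Binary.Permutation.Propositional.Properties using (↭-length; All-resp-↭; ∈-resp-↭; ++⁺ʳ; ++-assoc; ++-comm; shift)
import Data.List.Relation.Binary.Permutation.Setoid.Properties as Permutationₛ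
open import Data.Vec using (Vec; []; _∷_; lookup; _[_]≔_; toList; fromList)
import Data.Vec as Vec
open import Data.Vec.Properties using (lookup∘update; lookup∘update′; lookup∘tabulate; tabulate-cong; length-toList; toList∘fromList; map-id; map-∘; map-cong)
open import Data.Product using (Σ; ∃; ∃₂; _×_; _,_; proj₁; proj₂)
open import Data.Sum using (_⊎_; inj₁; inj₂)
open import Function using (_∘_; id)
open import Relation.Nullary using (¬_; Dec; yes; no; does; ¬?; contradiction)
open import Relation.Nullary.Decidable using (_×-dec_)
open import Relation.Binary.PropositionalEquality hiding ([_])
open import Algebra.Properties.CommutativeSemigroup *-commutativeSemigroup using (interchange; x∙yz≈y∙xz)
open import Algebra.Properties.Semiring.Sum +-*-semiring
  using (sum; ∑-comm; *-distribˡ-sum; *-distribʳ-sum; sum-cong-≗; sum-syntax)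

-- Sums and indicators

indicator : ∀ {P : Set} → Dec P → ℕ
indicator P? = if does P? then 1 else 0

indicator≤1 : ∀ {P : Set} (P? : Dec P) → indicator P? ≤ 1
indicator≤1 (yes _) = ≤-refl
indicator≤1 (no _)  = z≤n

indicator-yes : ∀ {P : Set} (P? : Dec P) → P → indicator P? ≡ 1
indicator-yes (yes _) p = refl
indicator-yes (no ¬p) p = contradiction p ¬p

indicator-no : ∀ {P : Set} (P? : Dec P) → ¬ P → indicator P? ≡ 0
indicator-no (yes p) ¬p = contradiction p ¬p
indicator-no (no _)  ¬p = refl

∑-mono : ∀ {q} {f g : Fin q → ℕ} → (∀ i → f i ≤ g i) → sum f ≤ sum g
∑-mono {zero}  f≤g = z≤n
∑-mono {suc q} f≤g = +-mono-≤ (f≤g F.zero) (∑-mono (f≤g ∘ F.suc))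

∑-const : ∀ q k → (∑[ i < q ] k) ≡ q * k
∑-const zero    k = refl
∑-const (suc q) k = cong (k +_) (∑-const q k)

∑-bound : ∀ {q} {f : Fin q → ℕ} {k} → (∀ i → f i ≤ k) → sum f ≤ q * k
∑-bound {q} f≤k = ≤-trans (∑-mono f≤k) (≤-reflexive (∑-const q _))

∑-bound-strict : ∀ {q} {f : Fin q → ℕ} {k} → (∀ i → f i ≤ k) → ∀ i → f i < k → sum f < q * k
∑-bound-strict f≤k F.zero    fi<k = +-mono-<-≤ fi<k (∑-bound (f≤k ∘ F.suc))
∑-bound-strict f≤k (F.suc i) fi<k = +-mono-≤-< (f≤k F.zero) (∑-bound-strict (f≤k ∘ F.suc) i fi<k)

∑-pigeonhole : ∀ {q} {f : Fin q → ℕ} {k} → sum f < q * k → ∃ λ i → f i < k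
∑-pigeonhole {suc q} {f} {k} ∑f<qk with f F.zero <? k
... | yes f0<k = F.zero , f0<k
... | no  f0≮k =
  let i , fi<k = ∑-pigeonhole {q} {f ∘ F.suc} (+-cancelˡ-< k _ _
                   (≤-<-trans (+-monoˡ-≤ _ (≮⇒≥ f0≮k)) ∑f<qk))
  in F.suc i , fi<k

∑≡0⇒≡0 : ∀ {q} {f : Fin q → ℕ} → sum f ≡ 0 → ∀ i → f i ≡ 0
∑≡0⇒≡0 {f = f} ∑f≡0 F.zero    = m+n≡0⇒m≡0 (f F.zero) ∑f≡0
∑≡0⇒≡0 {f = f} ∑f≡0 (F.suc i) = ∑≡0⇒≡0 (m+n≡0⇒n≡0 (f F.zero) ∑f≡0) i

∑-indicator-≡ : ∀ {q} (a : Fin q) → (∑[ c < q ] indicator (a ≟ᶠ c)) ≡ 1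
∑-indicator-≡ {suc q} F.zero    = cong suc (trans (∑-const q 0) (*-zeroʳ q))
∑-indicator-≡ {suc q} (F.suc a) = trans (sum-cong-≗ suc-≟) (∑-indicator-≡ a)
  where
  suc-≟ : ∀ c → indicator (F.suc a ≟ᶠ F.suc c) ≡ indicator (a ≟ᶠ c)
  suc-≟ c with a ≟ᶠ c
  ... | yes _ = refl
  ... | no _  = refl

-- Counting replaces probability: this is q^M times the expectation of `G` over a uniformly random
-- vector.
∑ⱽ : ∀ {q} M → (Vec (Fin q) M → ℕ) → ℕ
∑ⱽ         zero    G = G []
∑ⱽ {q = q} (suc M) G = ∑[ c < q ] ∑ⱽ M (G ∘ (c ∷_))

module _ {q : ℕ} where

  ∑ⱽ-cong : ∀ M {G H : Vec (Fin q) M → ℕ} → (∀ h → G h ≡ H h) → ∑ⱽ M G ≡ ∑ⱽ M H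
  ∑ⱽ-cong zero    G≗H = G≗H []
  ∑ⱽ-cong (suc M) G≗H = sum-cong-≗ {q} (λ c → ∑ⱽ-cong M (G≗H ∘ (c ∷_)))

  ∑ⱽ-mono : ∀ M {G H : Vec (Fin q) M → ℕ} → (∀ h → G h ≤ H h) → ∑ⱽ M G ≤ ∑ⱽ M H
  ∑ⱽ-mono zero    G≤H = G≤H []
  ∑ⱽ-mono (suc M) G≤H = ∑-mono {q} (λ c → ∑ⱽ-mono M (G≤H ∘ (c ∷_)))

  ∑ⱽ-const : ∀ M k → ∑ⱽ {q} M (λ _ → k) ≡ q ^ M * k
  ∑ⱽ-const zero    k = sym (*-identityˡ k)
  ∑ⱽ-const (suc M) k = trans (sum-cong-≗ {q} (λ _ → ∑ⱽ-const M k))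
    (trans (∑-const q (q ^ M * k)) (sym (*-assoc q (q ^ M) k)))

  *-distribˡ-∑ⱽ : ∀ M k (G : Vec (Fin q) M → ℕ) → k * ∑ⱽ M G ≡ ∑ⱽ M (λ h → k * G h)
  *-distribˡ-∑ⱽ zero    k G = refl
  *-distribˡ-∑ⱽ (suc M) k G = trans (*-distribˡ-sum {q} k (λ c → ∑ⱽ M (G ∘ (c ∷_))))
    (sum-cong-≗ {q} (λ c → *-distribˡ-∑ⱽ M k (G ∘ (c ∷_))))

  ∑ⱽ-∑-comm : ∀ M {K} (G : Fin K → Vec (Fin q) M → ℕ) →
              (∑[ e < K ] ∑ⱽ M (G e)) ≡ ∑ⱽ M (λ h → ∑[ e < K ] G e h)
  ∑ⱽ-∑-comm zero    G = refl
  ∑ⱽ-∑-comm (suc M) {K} G = trans (∑-comm {K} {q} (λ e c → ∑ⱽ M (G e ∘ (c ∷_))))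
    (sum-cong-≗ {q} (λ c → ∑ⱽ-∑-comm M (λ e → G e ∘ (c ∷_))))

  ∑ⱽ-comm : ∀ M {K} r (G : Vec (Fin K) r → Vec (Fin q) M → ℕ) →
            ∑ⱽ r (λ E → ∑ⱽ M (G E)) ≡ ∑ⱽ M (λ h → ∑ⱽ r (λ E → G E h))
  ∑ⱽ-comm M     zero    G = refl
  ∑ⱽ-comm M {K} (suc r) G = trans (sum-cong-≗ {K} (λ e → ∑ⱽ-comm M r (G ∘ (e ∷_))))
    (∑ⱽ-∑-comm M (λ e h → ∑ⱽ r (λ E → G (e ∷ E) h)))

  -- Overwriting a coordinate with a uniform value keeps the vector uniform: every vector arises
  -- from exactly `q` pairs `h`, `c`.
  ∑ⱽ-resample : ∀ M (p : Fin M) (G : Vec (Fin q) M → ℕ) →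
                q * ∑ⱽ M G ≡ ∑ⱽ M (λ h → ∑[ c < q ] G (h [ p ]≔ c))
  ∑ⱽ-resample (suc M) F.zero G = trans
    (cong (q *_) (∑ⱽ-∑-comm M (λ c → G ∘ (c ∷_))))
    (sym (∑-const q (∑ⱽ M (λ h → ∑[ c < q ] G (c ∷ h)))))
  ∑ⱽ-resample (suc M) (F.suc p) G = trans
    (*-distribˡ-sum {q} q (λ c → ∑ⱽ M (G ∘ (c ∷_))))
    (sum-cong-≗ {q} (λ c → ∑ⱽ-resample M p (G ∘ (c ∷_))))

  -- First-moment method: a natural-valued function of mean below 1 vanishes somewhere. The
  -- coordinates are fixed one at a time, by pigeonhole.
  ∑ⱽ-average : ∀ M (G : Vec (Fin q) M → ℕ) → ∑ⱽ M G < q ^ M → ∃ λ h → G h ≡ 0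
  ∑ⱽ-average zero    G G<1 = [] , n<1⇒n≡0 G<1
  ∑ⱽ-average (suc M) G G<  =
    let c , Gc< = ∑-pigeonhole {q} G<
        h , Gh≡0 = ∑ⱽ-average M (G ∘ (c ∷_)) Gc<
    in c ∷ h , Gh≡0

  ∑ⱽ≡0⇒≡0 : ∀ M {G : Vec (Fin q) M → ℕ} → ∑ⱽ M G ≡ 0 → ∀ h → G h ≡ 0
  ∑ⱽ≡0⇒≡0 zero    ∑G≡0 []      = ∑G≡0
  ∑ⱽ≡0⇒≡0 (suc M) ∑G≡0 (c ∷ h) = ∑ⱽ≡0⇒≡0 M (∑≡0⇒≡0 {q} ∑G≡0 c) h

-- Colourings that link every long sequence of triples

module Clauses (q M : ℕ) where

  Clause : Set
  Clause = (Fin M × Fin q) × (Fin M × Fin q)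

  Matches : Vec (Fin q) M → Clause → Set
  Matches h ((p , a) , (p′ , a′)) = lookup h p ≡ a × lookup h p′ ≡ a′

  matches? : ∀ h κ → Dec (Matches h κ)
  matches? h ((p , a) , (p′ , a′)) = (lookup h p ≟ᶠ a) ×-dec (lookup h p′ ≟ᶠ a′)

  avoid : Vec (Fin q) M → Clause → ℕ
  avoid h κ = indicator (¬? (matches? h κ))

  -- A product of indicators instead of a predicate, so that factors that do not read a resampled
  -- coordinate can be pulled out of a sum.
  avoidAll : Vec (Fin q) M → List Clause → ℕ
  avoidAll h κs = product (map (avoid h) κs)

  Fresh : Fin M → Clause → Set
  Fresh r ((p , _) , (p′ , _)) = r ≢ p × r ≢ p′

  Proper : Clause → Set
  Proper ((p , _) , (p′ , _)) = p ≢ p′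

  Disjoint : Clause → Clause → Set
  Disjoint ((p , _) , (p′ , _)) κ = Fresh p κ × Fresh p′ κ

  avoidAll-fresh : ∀ h r c κs → All (Fresh r) κs → avoidAll (h [ r ]≔ c) κs ≡ avoidAll h κs
  avoidAll-fresh h r c [] [] = refl
  avoidAll-fresh h r c (κ@((p , a) , (p′ , a′)) ∷ κs) ((r≢p , r≢p′) ∷ fresh) =
    cong₂ _*_
      (cong₂ (λ x y → indicator (¬? ((x ≟ᶠ a) ×-dec (y ≟ᶠ a′))))
        (lookup∘update′ (r≢p ∘ sym) h c) (lookup∘update′ (r≢p′ ∘ sym) h c))
      (avoidAll-fresh h r c κs fresh)

  avoidAll-one : ∀ h κs → All (λ κ → ¬ Matches h κ) κs → avoidAll h κs ≡ 1
  avoidAll-one h []       []       = refl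
  avoidAll-one h (κ ∷ κs) (¬m ∷ ¬ms) =
    cong₂ _*_ (indicator-yes (¬? (matches? h κ)) ¬m) (avoidAll-one h κs ¬ms)

  -- Of the q² ways to fill the two coordinates, the one writing `a` and `a′` matches the clause. As
  -- `p ≢ p′`, neither write destroys the other.
  ∑-avoid : ∀ h κ → Proper κ → let ((p , _) , (p′ , _)) = κ in
            (∑[ c′ < q ] ∑[ c < q ] avoid (h [ p′ ]≔ c′ [ p ]≔ c) κ) < q * q
  ∑-avoid h κ@((p , a) , (p′ , a′)) p≢p′ = subst (λ k → (∑[ c′ < q ] ∑[ c < q ] avoid (h [ p′ ]≔ c′ [ p ]≔ c) κ) < q * k) (*-identityʳ q)
    (∑-bound-strict (λ c′ → ∑-bound (avoid≤1 c′)) a′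
      (∑-bound-strict (avoid≤1 a′) a (s≤s (≤-reflexive
        (indicator-no (¬? (matches? (h [ p′ ]≔ a′ [ p ]≔ a) κ)) (λ ¬m → ¬m
          ( lookup∘update p (h [ p′ ]≔ a′) a
          , trans (lookup∘update′ (p≢p′ ∘ sym) (h [ p′ ]≔ a′) a) (lookup∘update p′ h a′))))))))
    where
    avoid≤1 : ∀ c′ c → avoid (h [ p′ ]≔ c′ [ p ]≔ c) κ ≤ 1
    avoid≤1 c′ c = indicator≤1 (¬? (matches? (h [ p′ ]≔ c′ [ p ]≔ c) κ))

  -- Disjoint clauses are independent: each is avoided by at most a fraction 1 − 1/q²
  -- of the assignments.
  ∑ⱽ-avoidAll : ∀ κs → All Proper κs → AllPairs Disjoint κs →
                (q * q) ^ length κs * ∑ⱽ M (λ h → avoidAll h κs) ≤ (q * q ∸ 1) ^ length κs * q ^ M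
  ∑ⱽ-avoidAll [] [] [] = ≤-reflexive (cong (1 *_) (trans (∑ⱽ-const M 1) (*-identityʳ (q ^ M))))
  ∑ⱽ-avoidAll (κ@((p , a) , (p′ , a′)) ∷ κs) (proper ∷ propers) (disj ∷ disjs) = begin
    Q * Q ^ R * ∑ⱽ M (λ h → avoid h κ * A h)
      ≡⟨ *-assoc³ q q (Q ^ R) _ ⟩
    Q ^ R * (q * (q * ∑ⱽ M (λ h → avoid h κ * A h)))
      -- One factor `q` each pays for resampling `p` and `p′`. The remaining clauses read neither,
      -- so `A h` leaves the inner sums.
      ≡⟨ cong (λ k → Q ^ R * (q * k)) (∑ⱽ-resample M p _) ⟩
    Q ^ R * (q * ∑ⱽ M (λ h → ∑[ c < q ] (avoid (h [ p ]≔ c) κ * A (h [ p ]≔ c))))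
      ≡⟨ cong (Q ^ R *_) (∑ⱽ-resample M p′ _) ⟩
    Q ^ R * ∑ⱽ M (λ h → ∑[ c′ < q ] ∑[ c < q ] (avoid (upd h c′ c) κ * A (upd h c′ c)))
      ≡⟨ cong (Q ^ R *_) (∑ⱽ-cong M (λ h → sum-cong-≗ {q} (λ c′ → sum-cong-≗ {q} (λ c →
           cong (avoid (upd h c′ c) κ *_) (A-upd h c′ c))))) ⟩
    Q ^ R * ∑ⱽ M (λ h → ∑[ c′ < q ] ∑[ c < q ] (avoid (upd h c′ c) κ * A h))
      ≡⟨ cong (Q ^ R *_) (∑ⱽ-cong M (λ h → trans
           (sum-cong-≗ {q} (λ c′ → sym (*-distribʳ-sum {q} (A h) (λ c → avoid (upd h c′ c) κ))))
           (sym (*-distribʳ-sum {q} (A h) (λ c′ → ∑[ c < q ] avoid (upd h c′ c) κ))))) ⟩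
    Q ^ R * ∑ⱽ M (λ h → (∑[ c′ < q ] ∑[ c < q ] avoid (upd h c′ c) κ) * A h)
      ≤⟨ *-monoʳ-≤ (Q ^ R) (∑ⱽ-mono M (λ h → *-monoˡ-≤ (A h) (<⇒≤pred (∑-avoid h κ proper)))) ⟩
    Q ^ R * ∑ⱽ M (λ h → (Q ∸ 1) * A h)
      ≡⟨ cong (Q ^ R *_) (sym (*-distribˡ-∑ⱽ M (Q ∸ 1) A)) ⟩
    Q ^ R * ((Q ∸ 1) * ∑ⱽ M A)
      ≡⟨ x∙yz≈y∙xz (Q ^ R) (Q ∸ 1) (∑ⱽ M A) ⟩
    (Q ∸ 1) * (Q ^ R * ∑ⱽ M A)
      ≤⟨ *-monoʳ-≤ (Q ∸ 1) (∑ⱽ-avoidAll κs propers disjs) ⟩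
    (Q ∸ 1) * ((Q ∸ 1) ^ R * q ^ M)
      ≡⟨ sym (*-assoc (Q ∸ 1) ((Q ∸ 1) ^ R) (q ^ M)) ⟩
    (Q ∸ 1) * (Q ∸ 1) ^ R * q ^ M ∎
    where
    open ≤-Reasoning
    Q = q * q
    R = length κs
    A = λ h → avoidAll h κs
    upd = λ (h : Vec (Fin q) M) c′ c → h [ p′ ]≔ c′ [ p ]≔ c
    A-upd : ∀ h c′ c → A (upd h c′ c) ≡ A h
    A-upd h c′ c = trans (avoidAll-fresh (h [ p′ ]≔ c′) p c κs (All.map proj₁ disj))
                         (avoidAll-fresh h p′ c′ κs (All.map proj₂ disj))
    *-assoc³ : ∀ x y z w → x * y * z * w ≡ z * (x * (y * w))
    *-assoc³ = solve 4 (λ x y z w → x :* y :* z :* w := z :* (x :* (y :* w))) refl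
      where open +-*-Solver

module Pairs (n q : ℕ) where

  open Clauses q (n * n) public

  cell : Fin n → Fin n → Fin (n * n)
  cell = combine

  -- A vertex u, its image v under the function in the middle, and the colour c that selects
  -- the neighbours of u.
  Triple : Set
  Triple = Fin n × Fin n × Fin q

  Apart : Triple → Triple → Set
  Apart (u , v , _) (u′ , v′ , _) = u ≢ u′ × v ≢ v′

  apart? : ∀ t t′ → Dec (Apart t t′)
  apart? (u , v , _) (u′ , v′ , _) = ¬? (u ≟ᶠ u′) ×-dec ¬? (v ≟ᶠ v′)

  -- Matched when v′ lies in colour class c of row u and v in class c′ of row u′. This is adjacency
  -- of u and u′ once those classes serve as neighbourhoods.
  link : Triple → Triple → Clause
  link (u , v , c) (u′ , v′ , c′) = (cell u v′ , c) , (cell u′ v , c′)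

  links : List Triple → List Clause
  links []       = []
  links (t ∷ ts) = map (link t) ts ++ links ts

  All-links : ∀ {P : Clause → Set} {ts} → AllPairs (λ t t′ → P (link t t′)) ts → All P (links ts)
  All-links []         = []
  All-links (pt ∷ pts) = All.++⁺ (All.map⁺ pt) (All-links pts)

  length-links : ∀ ts → length (links ts) * 2 ≡ length ts * (length ts ∸ 1)
  length-links []       = refl
  length-links (t ∷ ts) = begin
    length (map (link t) ts ++ links ts) * 2
      ≡⟨ cong (_* 2) (trans (length-++ (map (link t) ts)) (cong (_+ _) (length-map (link t) ts))) ⟩
    (length ts + length (links ts)) * 2
      ≡⟨ *-distribʳ-+ 2 (length ts) _ ⟩
    length ts * 2 + length (links ts) * 2
      ≡⟨ cong (length ts * 2 +_) (length-links ts) ⟩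
    length ts * 2 + length ts * (length ts ∸ 1)
      ≡⟨ lemma (length ts) ⟩
    suc (length ts) * length ts ∎
    where
    open ≡-Reasoning
    lemma : ∀ m → m * 2 + m * (m ∸ 1) ≡ suc m * m
    lemma zero    = refl
    lemma (suc m) = solve 1 (λ m → (con 1 :+ m) :* con 2 :+ (con 1 :+ m) :* m
                                  := (con 2 :+ m) :* (con 1 :+ m)) refl m
      where open +-*-Solver

  cell-≢ˡ : ∀ {u u′ v v′ : Fin n} → u ≢ u′ → cell u v ≢ cell u′ v′
  cell-≢ˡ u≢u′ eq = u≢u′ (combine-injectiveˡ {n} {n} _ _ _ _ eq)

  cell-≢ʳ : ∀ {u u′ v v′ : Fin n} → v ≢ v′ → cell u v ≢ cell u′ v′
  cell-≢ʳ v≢v′ eq = v≢v′ (combine-injectiveʳ {n} {n} _ _ _ _ eq)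

  links-proper : ∀ {ts} → AllPairs Apart ts → All Proper (links ts)
  links-proper []             = []
  links-proper (apart ∷ rest) =
    All.++⁺ (All.map⁺ (All.map (cell-≢ˡ ∘ proj₁) apart)) (links-proper rest)

  link-disjoint : ∀ t {ts} → All (Apart t) ts → AllPairs Apart ts →
                  AllPairs Disjoint (map (link t) ts)
  link-disjoint t []       []           = []
  link-disjoint t ((u≢u₁ , v≢v₁) ∷ at) (at₁ ∷ rest) =
    All.map⁺ (All.map (λ ((u≢u₂ , v≢v₂) , (u₁≢u₂ , v₁≢v₂)) →
        (cell-≢ʳ v₁≢v₂ , cell-≢ˡ u≢u₂)
      , (cell-≢ˡ (u≢u₁ ∘ sym) , cell-≢ˡ u₁≢u₂)) (All.zip (at , at₁)))
    ∷ link-disjoint t at rest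

  -- Separates the links of a triple from those among later triples: the former lie in row u or
  -- column v, the latter touch neither.
  links-avoid : ∀ {u v ts} → All (λ (u₁ , v₁ , _) → u ≢ u₁ × v ≢ v₁) ts →
                All (λ κ → (∀ w → Fresh (cell u w) κ) × (∀ w → Fresh (cell w v) κ)) (links ts)
  links-avoid []                       = []
  links-avoid ((u≢u₁ , v≢v₁) ∷ apart) = All.++⁺
    (All.map⁺ (All.map (λ (u≢u₂ , v≢v₂) →
        (λ w → cell-≢ˡ u≢u₁ , cell-≢ˡ u≢u₂)
      , (λ w → cell-≢ʳ v≢v₂ , cell-≢ʳ v≢v₁)) apart))
    (links-avoid apart)

  links-disjoint : ∀ {ts} → AllPairs Apart ts → AllPairs Disjoint (links ts)
  links-disjoint []                 = []
  links-disjoint {t ∷ ts} (apart ∷ rest) = AllPairs.++⁺ (link-disjoint t apart rest) (links-disjoint rest)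
    (All.map⁺ (All.universal
      (λ (u₁ , v₁ , _) → All.map (λ (row , col) → row v₁ , col u₁) (links-avoid apart)) ts))

  -- `Fin K` codes the triples, so that `∑ⱽ` can also range over sequences of triples.
  K : ℕ
  K = n * n * q

  attach : Fin q → Fin n × Fin n → Triple
  attach c (u , v) = u , v , c

  decode : Fin K → Triple
  decode e = let uv , c = remQuot q e in attach c (remQuot n uv)

  encode : Triple → Fin K
  encode (u , v , c) = combine (cell u v) c

  decode-encode : ∀ t → decode (encode t) ≡ t
  decode-encode (u , v , c) = trans
    (cong (λ (uv , c) → attach c (remQuot n uv)) (remQuot-combine (cell u v) c))
    (cong (attach c) (remQuot-combine u v))

  triples : ∀ {r} → Vec (Fin K) r → List Triple
  triples E = toList (Vec.map decode E)

  -- The indicator of pairwise apart triples without a matched link. Other sequences count 0, since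
  -- their links may share cells and need not be independent.
  bad : ∀ {r} → Vec (Fin K) r → Vec (Fin q) (n * n) → ℕ
  bad E h = if does (allPairs? apart? (triples E)) then avoidAll h (links (triples E)) else 0

  ∑ⱽ-bad : ∀ {r R} → R * 2 ≡ r * (r ∸ 1) → (E : Vec (Fin K) r) →
           (q * q) ^ R * ∑ⱽ (n * n) (bad E) ≤ (q * q ∸ 1) ^ R * q ^ (n * n)
  ∑ⱽ-bad {r} {R} R≡ E with allPairs? apart? (triples E)
  ... | yes apart = subst (λ R → (q * q) ^ R * ∑ⱽ (n * n) (λ h → avoidAll h (links (triples E)))
                                                  ≤ (q * q ∸ 1) ^ R * q ^ (n * n))
          (*-cancelʳ-≡ (length (links (triples E))) R 2 (trans (length-links (triples E))
            (trans (cong (λ r → r * (r ∸ 1)) (length-toList (Vec.map decode E))) (sym R≡))))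
          (∑ⱽ-avoidAll (links (triples E)) (links-proper apart) (links-disjoint apart))
  ... | no _ = ≤-trans (≤-reflexive (trans (cong ((q * q) ^ R *_)
                 (trans (∑ⱽ-const (n * n) 0) (*-zeroʳ (q ^ (n * n))))) (*-zeroʳ ((q * q) ^ R)))) z≤n

  Unlinked : Vec (Fin q) (n * n) → Triple → Triple → Set
  Unlinked h t t′ = ¬ Matches h (link t t′)

  bad≡1 : ∀ h ts → AllPairs Apart ts → AllPairs (Unlinked h) ts →
          bad (Vec.map encode (fromList ts)) h ≡ 1
  bad≡1 h ts apart unlinked
    rewrite sym (map-∘ decode encode (fromList ts))
          | map-cong decode-encode (fromList ts)
          | map-id (fromList ts)
          | toList∘fromList ts
    with allPairs? apart? ts
  ... | yes _ = avoidAll-one h (links ts) (All-links unlinked)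
  ... | no ¬a = contradiction apart ¬a

  -- Union bound over all sequences of r triples.
  ∃-linked-colouring : ∀ {r R} → R * 2 ≡ r * (r ∸ 1) → K ^ r * (q * q ∸ 1) ^ R < (q * q) ^ R →
    .{{NonZero q}} →
    ∃ λ h → ∀ ts → length ts ≡ r → AllPairs Apart ts → ¬ AllPairs (Unlinked h) ts
  ∃-linked-colouring {r} {R} R≡ K^r< = h , linked
    where
    open ≤-Reasoning
    total = ∑ⱽ r (λ E → ∑ⱽ (n * n) (bad E))
    total< : (q * q) ^ R * total < (q * q) ^ R * q ^ (n * n)
    total< = begin-strict
      (q * q) ^ R * total
        ≡⟨ *-distribˡ-∑ⱽ r ((q * q) ^ R) (λ E → ∑ⱽ (n * n) (bad E)) ⟩
      ∑ⱽ r (λ E → (q * q) ^ R * ∑ⱽ (n * n) (bad E))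
        ≤⟨ ∑ⱽ-mono r (∑ⱽ-bad {r} {R} R≡) ⟩
      ∑ⱽ {K} r (λ E → (q * q ∸ 1) ^ R * q ^ (n * n))
        ≡⟨ trans (∑ⱽ-const {K} r _) (sym (*-assoc (K ^ r) _ _)) ⟩
      K ^ r * (q * q ∸ 1) ^ R * q ^ (n * n)
        <⟨ *-monoˡ-< (q ^ (n * n)) {{m^n≢0 q (n * n)}} K^r< ⟩
      (q * q) ^ R * q ^ (n * n) ∎
    -- The mean number of bad sequences is below 1; exchanging the sums yields a colouring with
    -- none.
    exists = ∑ⱽ-average (n * n) (λ h → ∑ⱽ r (λ E → bad E h))
      (subst (_< q ^ (n * n)) (∑ⱽ-comm (n * n) r bad) (*-cancelˡ-< ((q * q) ^ R) _ _ total<))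
    h = proj₁ exists
    linked : ∀ ts → length ts ≡ r → AllPairs Apart ts → ¬ AllPairs (Unlinked h) ts
    linked ts refl apart unlinked = contradiction
      (trans (sym (bad≡1 h ts apart unlinked)) (∑ⱽ≡0⇒≡0 r (proj₂ exists) (Vec.map encode (fromList ts))))
      λ ()

m<suc[m/n]*n : ∀ m n .{{_ : NonZero n}} → m < suc (m / n) * n
m<suc[m/n]*n m n = begin-strict
  m                   ≡⟨ m≡m%n+[m/n]*n m n ⟩
  m % n + m / n * n   <⟨ +-monoˡ-< (m / n * n) (m%n<n m n) ⟩
  n + m / n * n       ∎
  where open ≤-Reasoning

length-filter-tabulate : ∀ {n} {A : Set} {P : A → Set} (P? : ∀ a → Dec (P a)) (f : Fin n → A) →
                         length (filter P? (tabulate f)) ≡ (∑[ i < n ] indicator (P? (f i)))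
length-filter-tabulate {zero}  P? f = refl
length-filter-tabulate {suc n} P? f with P? (f F.zero)
... | yes _ = cong suc (length-filter-tabulate P? (f ∘ F.suc))
... | no _  = length-filter-tabulate P? (f ∘ F.suc)

-- Adjacency, Ramsey's bound and clique covers

DistinctOn : ∀ {A B : Set} → (A → B) → List A → Set
DistinctOn f = AllPairs (λ u u′ → f u ≢ f u′)

module _ {n : ℕ} where

  Adjacent : (Fin n → List (Fin n)) → (Fin n → Fin n) → Fin n → Fin n → Set
  Adjacent N f u u′ = f u′ ∈ N u × f u ∈ N u′

  -- Random colouring of the cells; N u is a least frequent colour class of row u, so the size
  -- of N u is bounded without any concentration argument.
  ∃-graph : ∀ q {r R} .{{_ : NonZero q}} → R * 2 ≡ r * (r ∸ 1) →
    (n * n * q) ^ r * (q * q ∸ 1) ^ R < (q * q) ^ R →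
    ∃ λ N → (∀ u → length (N u) ≤ n / q) ×
      (∀ f us → length us ≡ r → DistinctOn f us → ¬ AllPairs (λ u u′ → ¬ Adjacent N f u u′) us)
  ∃-graph q {R = R} R≡ K^r< = N , (λ u → ≤-pred (proj₂ (rare u))) , dense
    where
    open Pairs n q
    colouring = ∃-linked-colouring {R = R} R≡ K^r<
    h = proj₁ colouring
    inClass? : ∀ u c v → Dec (lookup h (cell u v) ≡ c)
    inClass? u c v = lookup h (cell u v) ≟ᶠ c
    class : Fin n → Fin q → List (Fin n)
    class u c = filter (inClass? u c) (allFin n)
    ∑-class : ∀ u → (∑[ c < q ] length (class u c)) ≡ n
    ∑-class u = begin
      (∑[ c < q ] length (class u c))
        ≡⟨ sum-cong-≗ {q} (λ c → length-filter-tabulate (inClass? u c) id) ⟩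
      (∑[ c < q ] ∑[ v < n ] indicator (inClass? u c v))
        ≡⟨ ∑-comm {q} {n} (λ c v → indicator (inClass? u c v)) ⟩
      (∑[ v < n ] ∑[ c < q ] indicator (inClass? u c v))
        ≡⟨ sum-cong-≗ {n} (λ v → ∑-indicator-≡ (lookup h (cell u v))) ⟩
      (∑[ v < n ] 1)
        ≡⟨ trans (∑-const n 1) (*-identityʳ n) ⟩
      n ∎
      where open ≡-Reasoning
    -- The `q` classes partition the `n` columns of the row; if each had more than `n / q` members,
    -- they would have more than `n` in all.
    rare : ∀ u → ∃ λ c → length (class u c) < suc (n / q)
    rare u = ∑-pigeonhole {q} (subst₂ _<_ (sym (∑-class u)) (*-comm (suc (n / q)) q) (m<suc[m/n]*n n q))
    c : Fin n → Fin q
    c u = proj₁ (rare u)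
    N : Fin n → List (Fin n)
    N u = class u (c u)
    dense : ∀ f us → length us ≡ _ → DistinctOn f us → ¬ AllPairs (λ u u′ → ¬ Adjacent N f u u′) us
    dense f us |us|≡r distinct nonadjacent = proj₂ colouring (map triple us)
      (trans (length-map triple us) |us|≡r)
      (AllPairs.map⁺ (AllPairs.map (λ fu≢fu′ → fu≢fu′ ∘ cong f , fu≢fu′) distinct))
      (AllPairs.map⁺ (AllPairs.map (λ ¬adj (m , m′) → ¬adj (member m , member m′)) nonadjacent))
      where
      -- `f` enters only through these triples. As the colouring handles all sequences of triples, a
      -- single graph serves every `f`.
      triple = λ u → u , f u , c u
      member : ∀ {u v} → lookup h (cell u v) ≡ c u → v ∈ N u
      member {u} {v} = ∈-filter⁺ (inClass? u (c u)) (∈-allFin v)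

↭-refine : ∀ {A : Set} {xs ys zs} (us vs : List A) → xs ↭ ys ++ zs → ys ↭ us ++ vs → xs ↭ us ++ (vs ++ zs)
↭-refine {zs = zs} us vs xs↭ ys↭ = ↭-trans xs↭ (↭-trans (++⁺ʳ zs ys↭) (++-assoc us vs zs))

↭-insert : ∀ {A : Set} (x : A) {xs} ys {zs} → xs ↭ ys ++ zs → x ∷ xs ↭ ys ++ x ∷ zs
↭-insert x ys xs↭ = ↭-trans (↭-prep x xs↭) (↭-sym (shift x ys _))

AllPairs-++⁻ˡ : ∀ {A : Set} {R : A → A → Set} xs {ys} → AllPairs R (xs ++ ys) → AllPairs R xs
AllPairs-++⁻ˡ []       _          = []
AllPairs-++⁻ˡ (x ∷ xs) (px ∷ pxs) = All.++⁻ˡ xs px ∷ AllPairs-++⁻ˡ xs pxs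

module _ {A : Set} {R : A → A → Set} (R? : ∀ x y → Dec (R x y)) where

  -- With a vertex x put aside, either its neighbours or its non-neighbours are numerous.
  ramsey : ∀ r s xs → suc r ^ s ≤ length xs →
    (∃₂ λ I ys → xs ↭ I ++ ys × length I ≡ r × AllPairs (λ x y → ¬ R x y) I) ⊎
    (∃₂ λ C ys → xs ↭ C ++ ys × length C ≡ s × AllPairs R C)
  ramsey zero    s       xs       _    = inj₁ ([] , xs , ↭-refl , refl , [])
  ramsey (suc r) zero    xs       _    = inj₂ ([] , xs , ↭-refl , refl , [])
  ramsey (suc r) (suc s) []       size = contradiction size (<⇒≱ (m^n>0 (2 + r) (suc s)))
  ramsey (suc r) (suc s) (x ∷ xs) size with partition (R? x) xs
                                          | Permutationₛ.partition-↭ (setoid A) (R? x) xs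
                                          | All.partition-All (R? x) xs
  ... | nbrs , others | split | allR , all¬R
    -- These are the sizes that the recursive calls need. They add up to at most `(2 + r) ^ suc s`,
    -- so if both were missed, `x ∷ xs` would be too short.
    with (2 + r) ^ s ≤? length nbrs | suc r ^ suc s ≤? length others
  ... | yes big | _ with ramsey (suc r) s nbrs big
  ...   | inj₁ (I , ys , nbrs↭ , |I| , indep) =
    inj₁ (I , _ , ↭-refine I ys (↭-insert x nbrs (↭ₛ⇒↭ split)) nbrs↭ , |I| , indep)
  ...   | inj₂ (C , ys , nbrs↭ , |C| , clique) =
    inj₂ (x ∷ C , _ , ↭-prep x (↭-refine C ys (↭ₛ⇒↭ split) nbrs↭) , cong suc |C| ,
          All.++⁻ˡ C (All-resp-↭ nbrs↭ allR) ∷ clique)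
  ramsey (suc r) (suc s) (x ∷ xs) size | nbrs , others | split | allR , all¬R
      | no _ | yes big with ramsey r (suc s) others big
  ...   | inj₁ (I , ys , others↭ , |I| , indep) =
    inj₁ (x ∷ I , _ , ↭-prep x (↭-refine I ys (↭-trans (↭ₛ⇒↭ split) (++-comm nbrs others)) others↭) ,
          cong suc |I| , All.++⁻ˡ I (All-resp-↭ others↭ all¬R) ∷ indep)
  ...   | inj₂ (C , ys , others↭ , |C| , clique) =
    inj₂ (C , _ , ↭-refine C ys (↭-insert x others (↭-trans (↭ₛ⇒↭ split) (++-comm nbrs others))) others↭ ,
          |C| , clique)
  ramsey (suc r) (suc s) (x ∷ xs) size | nbrs , others | split | allR , all¬R
      | no small | no small′ = contradiction size (<⇒≱ (begin-strict
    suc (length xs)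
      ≡⟨ cong suc (trans (↭-length (↭ₛ⇒↭ split)) (length-++ nbrs)) ⟩
    suc (length nbrs) + length others
      <⟨ +-mono-≤-< (≰⇒> small) (≰⇒> small′) ⟩
    (2 + r) ^ s + suc r ^ suc s
      ≤⟨ +-monoʳ-≤ ((2 + r) ^ s) (*-monoʳ-≤ (suc r) (^-monoˡ-≤ s (n≤1+n (suc r)))) ⟩
    (2 + r) ^ s + suc r * (2 + r) ^ s ∎))
    where open ≤-Reasoning

module Cover {n : ℕ} (N : Fin n → List (Fin n)) (f : Fin n → Fin n) where

  open DecMembership (_≟ᶠ_ {n}) using (_∈?_)

  adjacent? : ∀ u u′ → Dec (Adjacent N f u u′)
  adjacent? u u′ = (f u′ ∈? N u) ×-dec (f u ∈? N u′)

  -- Density concerns only vertices with distinct images, so one vertex is kept for each image.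
  representatives : ∀ us → ∃₂ λ D ws → us ↭ D ++ ws × DistinctOn f D × All (λ u → Any (λ d → f u ≡ f d) D) us
  representatives []       = [] , [] , ↭-refl , [] , []
  representatives (u ∷ us) with representatives us
  ... | D , ws , us↭ , distinct , covered with any? (λ d → f u ≟ᶠ f d) D
  ...   | yes fu∈ = D , u ∷ ws , ↭-trans (↭-prep u us↭) (↭-sym (shift u D ws)) , distinct , fu∈ ∷ covered
  ...   | no  fu∉ = u ∷ D , ws , ↭-prep u us↭ , All.¬Any⇒All¬ D fu∉ ∷ distinct ,
                    here refl ∷ All.map there covered

  -- Singles cover images, not vertices: the bit at `f d` serves every `u` with `f u ≡ f d`.
  record Covering (r s : ℕ) (us : List (Fin n)) : Set where
    field
      cliques   : List (List (Fin n))
      singles   : List (Fin n)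
      clique    : All (AllPairs (Adjacent N f)) cliques
      |cliques| : length cliques * s ≤ length us
      |singles| : length singles ≤ suc r ^ s
      covered   : ∀ {u} → u ∈ us → Any (u ∈_) cliques ⊎ Any (λ d → f u ≡ f d) singles

  module _ (r s : ℕ) .{{_ : NonZero s}}
           (dense : ∀ us → length us ≡ r → DistinctOn f us → ¬ AllPairs (λ u u′ → ¬ Adjacent N f u u′) us) where

    -- Greedy: while at least `suc r ^ s` images remain, `ramsey` yields a clique of size `s`, as
    -- `dense` excludes the independent set, and the clique is removed. At the end one
    -- representative of each remaining image becomes a single. As `s` is positive, every removal
    -- shortens the list, whose length `fuel` bounds.
    covering : ∀ fuel us → length us ≤ fuel → Covering r s us
    covering fuel us fuel≥ with representatives us
    ... | D , ws , us↭ , distinct , represented with suc r ^ s ≤? length D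
    ...   | no small = record
      { cliques = [] ; singles = D ; clique = [] ; |cliques| = z≤n ; |singles| = <⇒≤ (≰⇒> small)
      ; covered = λ u∈us → inj₂ (All.lookup represented u∈us) }
    ...   | yes big with ramsey adjacent? r s D big
    ...     | inj₁ (I , ys , D↭ , |I| , indep) = contradiction indep (dense I |I|
      (AllPairs-++⁻ˡ I (Permutationₛ.AllPairs-resp-↭ (setoid _) (λ ≢ → ≢ ∘ sym) (resp₂ _) (↭⇒↭ₛ D↭) distinct)))
    ...     | inj₂ (C , ys , D↭ , |C| , cliqueC) = extend fuel fuel≥
      where
      rest = ys ++ ws
      us↭C++rest : us ↭ C ++ rest
      us↭C++rest = ↭-refine C ys us↭ D↭
      |us| : length us ≡ s + length rest
      |us| = trans (↭-length us↭C++rest) (trans (length-++ C) (cong (_+ length rest) |C|))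
      extend : ∀ fuel → length us ≤ fuel → Covering r s us
      extend zero       fuel≥ = contradiction (≤-trans (≤-reflexive (sym |us|)) fuel≥)
                                  (<⇒≱ (<-≤-trans (>-nonZero⁻¹ s) (m≤m+n s (length rest))))
      extend (suc fuel) fuel≥ = record
        { cliques = C ∷ cliques ; singles = singles ; clique = cliqueC ∷ clique
        ; |cliques| = ≤-trans (+-monoʳ-≤ s |cliques|) (≤-reflexive (sym |us|))
        ; |singles| = |singles|
        ; covered = λ u∈us → cover-++ (∈-++⁻ C (∈-resp-↭ us↭C++rest u∈us)) }
        where
        open Covering (covering fuel rest (≤-pred (≤-trans
               (≤-trans (+-monoˡ-≤ (length rest) (>-nonZero⁻¹ s)) (≤-reflexive (sym |us|))) fuel≥)))
        cover-++ : ∀ {u} → u ∈ C ⊎ u ∈ rest → Any (u ∈_) (C ∷ cliques) ⊎ Any (λ d → f u ≡ f d) singles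
        cover-++ (inj₁ u∈C)    = inj₁ (here u∈C)
        cover-++ (inj₂ u∈rest) with covered u∈rest
        ... | inj₁ in-clique = inj₁ (there in-clique)
        ... | inj₂ in-single = inj₂ in-single

  parity : (Fin n → Bool) → List (Fin n) → Bool
  parity y = foldr (λ u b → y (f u) xor b) false

  parity-cong : ∀ {y y′ us} → All (λ u → y (f u) ≡ y′ (f u)) us → parity y us ≡ parity y′ us
  parity-cong []           = refl
  parity-cong {y} {y′} (yfu≡ ∷ eqs) = cong₂ _xor_ yfu≡ (parity-cong {y} {y′} eqs)

  xor-cancelˡ : ∀ b {c c′} → b xor c ≡ b xor c′ → c ≡ c′
  xor-cancelˡ false eq = eq
  xor-cancelˡ true  eq = Bool.not-injective eq

  xor-cancelʳ : ∀ {b b′} c → b xor c ≡ b′ xor c → b ≡ b′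
  xor-cancelʳ {b} {b′} c eq = xor-cancelˡ c (trans (Bool.xor-comm c b) (trans eq (Bool.xor-comm b′ c)))

  -- Every other member w has `f w ∈ N u`, so its bit is known and cancels from the parities,
  -- leaving the bit at `f u`. Knowledge is phrased as agreement of two strings.
  clique-determines : ∀ {y y′ u C} → AllPairs (Adjacent N f) C → u ∈ C →
    All (λ v → y v ≡ y′ v) (N u) → parity y C ≡ parity y′ C → y (f u) ≡ y′ (f u)
  clique-determines {y} {y′} {C = w ∷ C} (adj ∷ _) (here refl) known eq =
    xor-cancelʳ _ (trans eq (cong (y′ (f w) xor_) (sym (parity-cong {y} {y′} (All.map (All.lookup known ∘ proj₁) adj)))))
  clique-determines {y} {y′} {u} {w ∷ C} (adj ∷ clique) (there u∈C) known eq =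
    clique-determines clique u∈C known
      (xor-cancelˡ (y (f w)) (trans eq (cong (λ b → b xor parity y′ C) (sym (All.lookup known (proj₂ (All.lookup adj u∈C)))))))

  module _ {r s us} (cov : Covering r s us) where
    open Covering cov

    -- Singles enter as one-element lists, so that parities serve for both kinds of announcement.
    queries : List (List (Fin n))
    queries = cliques ++ map [_] singles

    |queries| : .{{_ : NonZero s}} → length queries ≤ length us / s + suc r ^ s
    |queries| = begin
      length queries                       ≡⟨ length-++ cliques ⟩
      length cliques + length (map [_] singles)
        ≤⟨ +-mono-≤ (≤-trans (≤-reflexive (sym (m*n/n≡m (length cliques) s))) (/-monoˡ-≤ s |cliques|))
                    (≤-trans (≤-reflexive (length-map [_] singles)) |singles|) ⟩
      length us / s + suc r ^ s            ∎
      where open ≤-Reasoning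

    queries-determine : ∀ {y y′ u} → u ∈ us → All (λ C → parity y C ≡ parity y′ C) queries →
      All (λ v → y v ≡ y′ v) (N u) → y (f u) ≡ y′ (f u)
    queries-determine {y} {y′} u∈us answers known with covered u∈us
    ... | inj₁ in-clique =
      let C , C∈ , u∈C = find in-clique
      in clique-determines (All.lookup clique C∈) u∈C known (All.lookup answers (∈-++⁺ˡ C∈))
    ... | inj₂ in-single =
      let d , d∈ , fu≡fd = find in-single
      in trans (cong y fu≡fd) (trans
           (xor-cancelʳ false (All.lookup answers (∈-++⁺ʳ cliques (∈-map⁺ [_] d∈))))
           (cong y′ (sym fu≡fd)))

-- The protocol

map-≡⇒All : ∀ {A B : Set} {g h : A → B} xs → map g xs ≡ map h xs → All (λ x → g x ≡ h x) xs
map-≡⇒All []       eq = []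
map-≡⇒All (x ∷ xs) eq = proj₁ (∷-injective eq) ∷ map-≡⇒All xs (proj₂ (∷-injective eq))

compose-cong : ∀ {n} m {fs gs : Fin m → Fin n → Fin n} → (∀ l r → fs l r ≡ gs l r) →
               ∀ i → compose m fs i ≡ compose m gs i
compose-cong zero    fs≗gs i = refl
compose-cong (suc m) {fs} {gs} fs≗gs i = trans (compose-cong m (fs≗gs ∘ F.suc) (fs F.zero i))
  (cong (compose m (gs ∘ F.suc)) (fs≗gs F.zero i))

module _ {n : ℕ} (N : Fin n → List (Fin n)) {a : ℕ} (N-small : ∀ u → length (N u) ≤ a)
         (r s : ℕ) .{{_ : NonZero s}}
         (dense : ∀ f us → length us ≡ r → DistinctOn f us → ¬ AllPairs (λ u u′ → ¬ Adjacent N f u u′) us)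
         (m : ℕ) where

  private
    k = 3 + m

  -- Functions become vectors so that pointwise equal components are equal.
  first : Input k n → Vec (Fin n) n
  first I = Vec.tabulate (fun I F.zero)

  rest : Input k n → Vec Bool n
  rest I = Vec.tabulate (λ v → bits I (compose m (fun I ∘ F.suc) v))

  first-cong : ∀ {I I′ : Input k n} → (∀ v → fun I F.zero v ≡ fun I′ F.zero v) → first I ≡ first I′
  first-cong = tabulate-cong

  rest-cong : ∀ {I I′ : Input k n} → (∀ v → bits I v ≡ bits I′ v) →
              (∀ l v → fun I (F.suc l) v ≡ fun I′ (F.suc l) v) → rest I ≡ rest I′
  rest-cong {I} {I′} bits≗ fun≗ = tabulate-cong (λ v →
    trans (bits≗ _) (cong (bits I′) (compose-cong m fun≗ v)))

  mpj≡ : ∀ I → mpj I ≡ lookup (rest I) (lookup (first I) (start I))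
  mpj≡ I = trans
    (sym (lookup∘tabulate (λ v → bits I (compose m (fun I ∘ F.suc) v)) (fun I F.zero (start I))))
    (cong (lookup (rest I)) (sym (lookup∘tabulate (fun I F.zero) (start I))))

  module _ (f : Vec (Fin n) n) where
    open Cover N (lookup f)

    cover : Covering r s (allFin n)
    cover = covering r s (dense (lookup f)) n (allFin n) (≤-reflexive (length-tabulate (λ i → i)))

    message₁ : Vec Bool n → List Bool
    message₁ y = map (parity (lookup y)) (queries cover)

    |message₁| : ∀ y → length (message₁ y) ≤ n / s + suc r ^ s
    |message₁| y = ≤-trans (≤-reflexive (length-map (parity (lookup y)) (queries cover)))
      (subst (λ k → length (queries cover) ≤ k / s + suc r ^ s) (length-tabulate (λ i → i)) (|queries| cover))

  message₂ : Fin n → Vec Bool n → List Bool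
  message₂ u y = map (lookup y) (N u)

  |message₂| : ∀ u y → length (message₂ u y) ≤ a
  |message₂| u y = ≤-trans (≤-reflexive (length-map (lookup y) (N u))) (N-small u)

  transcript : Fin n → Vec (Fin n) n → Vec Bool n → Board
  transcript u f y = message₁ f y ∷ message₂ u y ∷ []

  transcript-determines : ∀ u f y y′ → transcript u f y ≡ transcript u f y′ →
                          lookup y (lookup f u) ≡ lookup y′ (lookup f u)
  transcript-determines u f y y′ eq = queries-determine (cover f) {lookup y} {lookup y′} (∈-allFin u)
    (map-≡⇒All (queries (cover f)) (proj₁ (∷-injective eq)))
    (map-≡⇒All (N u) (proj₁ (∷-injective (proj₂ (∷-injective eq)))))
    where open Cover N (lookup f)

  -- `Vec Bool n` is the type of subsets of `Fin n`, so `anySubset?` searches all strings. `take 2`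
  -- drops the empty messages of the players in between.
  consistent? : ∀ u f B → Dec (∃ λ y → transcript u f y ≡ take 2 B)
  consistent? u f B = anySubset? (λ y → ≡-dec (≡-dec Bool._≟_) (transcript u f y) (take 2 B))

  -- The last player looks for any y with the observed transcript: it has the right bit even if
  -- it is not the true one.
  answer : Fin n → Vec (Fin n) n → Board → List Bool
  answer u f B with consistent? u f B
  ... | yes (y , _) = [ lookup y (lookup f u) ]
  -- A default for boards that the last player never meets; the view condition ranges over all
  -- boards.
  ... | no _        = []

  |answer| : ∀ u f B → length (answer u f B) ≤ 1
  |answer| u f B with consistent? u f B
  ... | yes _ = ≤-refl
  ... | no _  = z≤n

  answer-correct : ∀ u f y B → transcript u f y ≡ take 2 B → answer u f B ≡ [ lookup y (lookup f u) ]
  answer-correct u f y B eq with consistent? u f B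
  ... | yes (y′ , eq′) = cong [_] (transcript-determines u f y′ y (trans eq′ (sym eq)))
  ... | no none        = contradiction (y , eq) none

  protocol : Protocol k n
  protocol 0             I B = message₁ (first I) (rest I)
  protocol 1             I B = message₂ (start I) (rest I)
  protocol (suc (suc j)) I B with j ≟ m
  ... | yes _ = answer (start I) (first I) B
  ... | no _  = []

  -- The first message does not read `start`, the second does not read f₂, and the last reads only
  -- `start`, f₂ and the board.
  protocol-view : ∀ j → j < k → ∀ I I′ B → AgreeExcept k j I I′ → protocol j I B ≡ protocol j I′ B
  protocol-view 0 _ I I′ B (_ , bits≗ , fun≗) =
    cong₂ message₁ (first-cong {I} {I′} (fun≗ F.zero λ ()))
                   (rest-cong {I} {I′} (bits≗ λ ()) (λ l → fun≗ (F.suc l) λ ()))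
  protocol-view 1 _ I I′ B (start≡ , bits≗ , fun≗) =
    cong₂ message₂ (start≡ λ ()) (rest-cong {I} {I′} (bits≗ λ ()) (λ l → fun≗ (F.suc l) λ ()))
  protocol-view (suc (suc j)) _ I I′ B (start≡ , bits≗ , fun≗) with j ≟ m
  ... | yes _ = cong₂ (λ u f → answer u f B) (start≡ λ ()) (first-cong {I} {I′} (fun≗ F.zero λ ()))
  ... | no _  = refl

  board-prefix : ∀ I t → take 2 (board protocol I (2 + t)) ≡ transcript (start I) (first I) (rest I)
  board-prefix I t = let w , eq = starts t in cong (take 2) eq
    where
    starts : ∀ t → ∃ λ w → board protocol I (2 + t) ≡ transcript (start I) (first I) (rest I) ++ w
    starts zero    = [] , refl
    starts (suc t) = let w , eq = starts t in w ++ _ , cong (_++ [ protocol (2 + t) I (board protocol I (2 + t)) ]) eq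

  size : Board → ℕ
  size B = ListAction.sum (map length B)

  size-snoc : ∀ B w → size (B ++ [ w ]) ≡ size B + length w
  size-snoc B w = trans (cong ListAction.sum (map-++ length B [ w ]))
    (trans (sum-++ (map length B) [ length w ]) (cong (size B +_) (+-identityʳ (length w))))

  board-size : ∀ I t → t ≤ m → size (board protocol I (2 + t)) ≤ n / s + suc r ^ s + a
  board-size I zero    _   = +-mono-≤ (|message₁| (first I) (rest I))
    (≤-trans (≤-reflexive (+-identityʳ _)) (|message₂| (start I) (rest I)))
  board-size I (suc t) t<m = ≤-trans (≤-reflexive (size-snoc (board protocol I (2 + t)) _))
    (≤-trans (≤-reflexive (trans (cong (λ w → size (board protocol I (2 + t)) + length w) silent) (+-identityʳ _)))
             (board-size I t (<⇒≤ t<m)))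
    where
    silent : protocol (2 + t) I (board protocol I (2 + t)) ≡ []
    silent with t ≟ m
    ... | yes t≡m = contradiction t≡m (<⇒≢ t<m)
    ... | no _    = refl

  last≡answer : ∀ I B → protocol (2 + m) I B ≡ answer (start I) (first I) B
  last≡answer I B with m ≟ m
  ... | yes _  = refl
  ... | no m≢m = contradiction refl m≢m

  protocol-cost : ∀ I → cost protocol I ≤ n / s + suc r ^ s + a + 1
  protocol-cost I = ≤-trans (≤-reflexive (size-snoc B _))
    (+-mono-≤ (board-size I m ≤-refl)
      (subst (λ w → length w ≤ 1) (sym (last≡answer I B)) (|answer| (start I) (first I) B)))
    where B = board protocol I (2 + m)

  protocol-correct : Correct protocol
  protocol-correct = protocol-view , λ I → let B = board protocol I (2 + m) in
    trans (last≡answer I B) (trans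
      (answer-correct (start I) (first I) (rest I) B (sym (board-prefix I m)))
      (cong [_] (sym (mpj≡ I))))

  costAtMost : CostAtMost k n (n / s + suc r ^ s + a + 1)
  costAtMost = protocol , protocol-correct , protocol-cost

-- Arithmetic of the parameters

^-distribʳ-* : ∀ k m n → (m * n) ^ k ≡ m ^ k * n ^ k
^-distribʳ-* zero    m n = refl
^-distribʳ-* (suc k) m n = trans (cong (m * n *_) (^-distribʳ-* k m n)) (interchange m n (m ^ k) (n ^ k))

-- The first two terms of the binomial expansion of the right-hand side.
bernoulli : ∀ a m → a ^ suc m + suc m * a ^ m ≤ suc a ^ suc m
bernoulli a zero    = ≤-reflexive (solve 1 (λ a → a :* con 1 :+ con 1 := (con 1 :+ a) :* con 1) refl a)
  where open +-*-Solver
bernoulli a (suc m) = begin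
  a * (a * a ^ m) + (2 + m) * (a * a ^ m)
    ≤⟨ m≤m+n _ (suc m * a ^ m) ⟩
  a * (a * a ^ m) + (2 + m) * (a * a ^ m) + suc m * a ^ m
    ≡⟨ solve 3 (λ a m x → a :* (a :* x) :+ (con 2 :+ m) :* (a :* x) :+ (con 1 :+ m) :* x
                        := (con 1 :+ a) :* (a :* x :+ (con 1 :+ m) :* x)) refl a m (a ^ m) ⟩
  suc a * (a * a ^ m + suc m * a ^ m)
    ≤⟨ *-monoʳ-≤ (suc a) (bernoulli a m) ⟩
  suc a * suc a ^ suc m ∎
  where
  open ≤-Reasoning
  open +-*-Solver

-- That is, (1 - 1/Q)^Q ≤ 1/2 for Q = a + 1, free of fractions.
2*a^[1+a]≤[1+a]^[1+a] : ∀ a → 2 * a ^ suc a ≤ suc a ^ suc a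
2*a^[1+a]≤[1+a]^[1+a] a = begin
  2 * a ^ suc a                    ≡⟨ cong (a ^ suc a +_) (+-identityʳ _) ⟩
  a ^ suc a + a * a ^ a            ≤⟨ +-monoʳ-≤ (a ^ suc a) (*-monoˡ-≤ (a ^ a) (n≤1+n a)) ⟩
  a ^ suc a + suc a * a ^ a        ≤⟨ bernoulli a a ⟩
  suc a ^ suc a                    ∎
  where open ≤-Reasoning

2^w*[Q∸1]^[Qw]≤Q^[Qw] : ∀ Q w .{{_ : NonZero Q}} → 2 ^ w * (Q ∸ 1) ^ (Q * w) ≤ Q ^ (Q * w)
2^w*[Q∸1]^[Qw]≤Q^[Qw] Q@(suc a) w = begin
  2 ^ w * a ^ (Q * w)      ≡⟨ cong (2 ^ w *_) (sym (^-*-assoc a Q w)) ⟩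
  2 ^ w * (a ^ Q) ^ w      ≡⟨ sym (^-distribʳ-* w 2 (a ^ Q)) ⟩
  (2 * a ^ Q) ^ w          ≤⟨ ^-monoˡ-≤ w (2*a^[1+a]≤[1+a]^[1+a] a) ⟩
  (Q ^ Q) ^ w              ≡⟨ ^-*-assoc Q Q w ⟩
  Q ^ (Q * w)              ∎
  where open ≤-Reasoning

-- There are fewer than 2^(wr) sequences, each bad with probability at most (1 - 1/Q)^(Qwr) ≤
-- 2^(-wr). `2 ≤ Q` keeps the power of `Q ∸ 1` positive, so that strictness survives.
union-bound : ∀ {K Q w r} .{{_ : NonZero r}} → 2 ≤ Q → K < 2 ^ w →
              K ^ r * (Q ∸ 1) ^ (Q * (w * r)) < Q ^ (Q * (w * r))
union-bound {K} {Q@(suc (suc _))} {w} {r} (s≤s (s≤s _)) K< = begin-strict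
  K ^ r * (Q ∸ 1) ^ (Q * (w * r))
    <⟨ *-monoˡ-< _ {{m^n≢0 (Q ∸ 1) (Q * (w * r))}} (^-monoˡ-< r K<) ⟩
  (2 ^ w) ^ r * (Q ∸ 1) ^ (Q * (w * r))
    ≡⟨ cong (_* (Q ∸ 1) ^ (Q * (w * r))) (^-*-assoc 2 w r) ⟩
  2 ^ (w * r) * (Q ∸ 1) ^ (Q * (w * r))
    ≤⟨ 2^w*[Q∸1]^[Qw]≤Q^[Qw] Q (w * r) ⟩
  Q ^ (Q * (w * r)) ∎
  where open ≤-Reasoning

2^⌊log₂n⌋≤n : ∀ n → 1 ≤ n → 2 ^ ⌊log₂ n ⌋ ≤ n
2^⌊log₂n⌋≤n = <-rec (λ n → 1 ≤ n → 2 ^ ⌊log₂ n ⌋ ≤ n) step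
  where
  open ≤-Reasoning
  step : ∀ n → (∀ {m} → m < n → 1 ≤ m → 2 ^ ⌊log₂ m ⌋ ≤ m) → 1 ≤ n → 2 ^ ⌊log₂ n ⌋ ≤ n
  step 1                 rec _ = ≤-refl
  step n@(suc (suc n-2)) rec _ = begin
    2 ^ ⌊log₂ n ⌋
      ≡⟨ cong (2 ^_) (sym (m+[n∸m]≡n (⌊log₂⌋-mono-≤ {2} {n} (s≤s (s≤s z≤n))))) ⟩
    2 * 2 ^ (⌊log₂ n ⌋ ∸ 1)
      ≡⟨ cong (λ e → 2 * 2 ^ e) (sym (⌊log₂⌊n/2⌋⌋≡⌊log₂n⌋∸1 n)) ⟩
    2 * 2 ^ ⌊log₂ ⌊ n /2⌋ ⌋
      ≤⟨ *-monoʳ-≤ 2 (rec (⌊n/2⌋<n (suc n-2)) (s≤s z≤n)) ⟩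
    2 * ⌊ n /2⌋
      ≡⟨ cong (⌊ n /2⌋ +_) (+-identityʳ _) ⟩
    ⌊ n /2⌋ + ⌊ n /2⌋
      ≤⟨ +-monoʳ-≤ ⌊ n /2⌋ (⌊n/2⌋≤⌈n/2⌉ n) ⟩
    ⌊ n /2⌋ + ⌈ n /2⌉
      ≡⟨ ⌊n/2⌋+⌈n/2⌉≡n n ⟩
    n ∎

n<2^[1+⌊log₂n⌋] : ∀ n → n < 2 ^ suc ⌊log₂ n ⌋
n<2^[1+⌊log₂n⌋] n = ≰⇒> λ 2^≤n → 1+n≰n
  (≤-trans (≤-reflexive (sym (⌊log₂[2^n]⌋≡n (suc ⌊log₂ n ⌋)))) (⌊log₂⌋-mono-≤ 2^≤n))

n<2^n : ∀ n → n < 2 ^ n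
n<2^n zero    = s≤s z≤n
n<2^n (suc n) = begin-strict
  1 + n          <⟨ +-mono-≤-< (m^n>0 2 n) (n<2^n n) ⟩
  2 ^ n + 2 ^ n  ≡⟨ cong (2 ^ n +_) (sym (+-identityʳ _)) ⟩
  2 ^ suc n      ∎
  where open ≤-Reasoning

-- Ensures that the clique size `s` is positive. The base case is 60 ≤ 64, whence the threshold 6
-- for log log n.
10*t≤2^t : ∀ {t} → 6 ≤ t → 10 * t ≤ 2 ^ t
10*t≤2^t 6≤t = subst (λ t → 10 * t ≤ 2 ^ t) (m+[n∸m]≡n 6≤t) (shifted _)
  where
  open ≤-Reasoning
  shifted : ∀ d → 10 * (6 + d) ≤ 2 ^ (6 + d)
  shifted zero    = ≤ᵇ⇒≤ 60 64 _
  shifted (suc d) = begin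
    10 * (7 + d)                 ≡⟨ *-distribˡ-+ 10 1 (6 + d) ⟩
    10 + 10 * (6 + d)            ≤⟨ +-monoˡ-≤ _ (m≤m*n 10 (6 + d)) ⟩
    10 * (6 + d) + 10 * (6 + d)  ≤⟨ +-mono-≤ (shifted d) (shifted d) ⟩
    2 ^ (6 + d) + 2 ^ (6 + d)    ≡⟨ cong (2 ^ (6 + d) +_) (sym (+-identityʳ _)) ⟩
    2 ^ (7 + d)                  ∎

-- n, l and t stand for n, log n and log log n.
module Parameters (n l t : ℕ) (2^l≤n : 2 ^ l ≤ n) (n<2^[1+l] : n < 2 ^ suc l)
                  (2^t≤l : 2 ^ t ≤ l) (l<2^[1+t] : l < 2 ^ suc t) (6≤t : 6 ≤ t) where

  open ≤-Reasoning

  64≤l : 64 ≤ l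
  64≤l = ≤-trans (^-monoʳ-≤ 2 6≤t) 2^t≤l

  instance
    l≢0 : NonZero l
    l≢0 = >-nonZero (≤-trans (s≤s z≤n) 64≤l)

    10t≢0 : NonZero (10 * t)
    10t≢0 = >-nonZero (≤-trans (s≤s z≤n) (*-monoʳ-≤ 10 6≤t))

  1≤t : 1 ≤ t
  1≤t = ≤-trans (s≤s z≤n) 6≤t

  l<n : l < n
  l<n = <-≤-trans (n<2^n l) 2^l≤n

  t≤l : t ≤ l
  t≤l = ≤-trans (<⇒≤ (n<2^n t)) 2^t≤l

  -- With `l` colours, a link between apart triples is matched with probability 1/`Q`. `2 ^ w`
  -- exceeds the number n²l of triples, each of the three factors being below 2^(l+1). `R` must be
  -- the number r(r - 1)/2 of pairs and equal Qwr for the union bound, which forces r = 2Qw + 1.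
  Q w r R s : ℕ
  Q = l * l
  w = suc l * 3
  r = suc (2 * (Q * w))
  R = Q * (w * r)
  s = l / (10 * t)

  n*n*l<2^w : n * n * l < 2 ^ w
  n*n*l<2^w = begin-strict
    n * n * l        <⟨ *-mono-< (*-mono-< n<2^[1+l] n<2^[1+l]) (<-trans l<n n<2^[1+l]) ⟩
    B * B * B        ≡⟨ solve 1 (λ B → B :* B :* B := B :^ 3) refl B ⟩
    B ^ 3            ≡⟨ ^-*-assoc 2 (suc l) 3 ⟩
    2 ^ (suc l * 3)  ∎
    where
    open +-*-Solver
    B = 2 ^ suc l

  R-pairs : R * 2 ≡ r * (r ∸ 1)
  R-pairs = solve 3 (λ Q w r → Q :* (w :* r) :* con 2 := r :* (con 2 :* (Q :* w))) refl Q w r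
    where open +-*-Solver

  few-sequences : (n * n * l) ^ r * (l * l ∸ 1) ^ R < (l * l) ^ R
  few-sequences = union-bound {n * n * l} {l * l} {w} {r}
    (≤-trans (≤ᵇ⇒≤ 2 64 _) (≤-trans 64≤l (m≤m*n l l))) n*n*l<2^w

  1≤s : 1 ≤ s
  1≤s = m≥n⇒m/n>0 (≤-trans (10*t≤2^t 6≤t) 2^t≤l)

  instance
    s≢0 : NonZero s
    s≢0 = >-nonZero 1≤s

  suc-r≤l^4 : suc r ≤ l ^ 4
  suc-r≤l^4 = subst (λ l → 2 + 2 * (l * l * (suc l * 3)) ≤ l ^ 4)
    (m+[n∸m]≡n (≤-trans (≤ᵇ⇒≤ 8 64 _) 64≤l)) (shifted (l ∸ 8))
    where
    open +-*-Solver
    shifted : ∀ x → 2 + 2 * ((8 + x) * (8 + x) * ((9 + x) * 3)) ≤ (8 + x) ^ 4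
    -- In x = l - 8 the difference of the two sides is a polynomial with nonnegative coefficients.
    shifted x = ≤-trans (m≤m+n _ (x ^ 4 + 26 * x ^ 3 + 234 * x ^ 2 + 800 * x + 638))
      (≤-reflexive (solve 1 (λ x →
        con 2 :+ con 2 :* ((con 8 :+ x) :* (con 8 :+ x) :* ((con 9 :+ x) :* con 3))
          :+ (x :^ 4 :+ con 26 :* x :^ 3 :+ con 234 :* x :^ 2 :+ con 800 :* x :+ con 638)
        := (con 8 :+ x) :^ 4) refl x))

  l≤2^2t : l ≤ 2 ^ (2 * t)
  l≤2^2t = ≤-trans (<⇒≤ l<2^[1+t]) (^-monoʳ-≤ 2 (≤-trans (+-monoˡ-≤ t 1≤t) (≤-reflexive (cong (t +_) (sym (+-identityʳ t))))))

  -- From `suc r` ≤ l⁴ ≤ 2^(8t) the power is at most 2^(8ts), and l ≤ 2^(2t) ≤ 2^(2ts). The total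
  -- exponent 10ts is at most `l`, which is why `s` divides by `10 * t`.
  r^s*l≤n : suc r ^ s * l ≤ n
  r^s*l≤n = begin
    suc r ^ s * l
      ≤⟨ *-mono-≤ (^-monoˡ-≤ s suc-r≤l^4) l≤2^2t ⟩
    (l ^ 4) ^ s * 2 ^ (2 * t)
      ≤⟨ *-monoˡ-≤ (2 ^ (2 * t)) (^-monoˡ-≤ s (^-monoˡ-≤ 4 l≤2^2t)) ⟩
    ((2 ^ (2 * t)) ^ 4) ^ s * 2 ^ (2 * t)
      ≡⟨ cong (_* 2 ^ (2 * t)) (trans (cong (_^ s) (^-*-assoc 2 (2 * t) 4)) (^-*-assoc 2 (2 * t * 4) s)) ⟩
    2 ^ (2 * t * 4 * s) * 2 ^ (2 * t)
      ≤⟨ *-monoʳ-≤ (2 ^ (2 * t * 4 * s)) (^-monoʳ-≤ 2 (m≤m*n (2 * t) s)) ⟩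
    2 ^ (2 * t * 4 * s) * 2 ^ (2 * t * s)
      ≡⟨ sym (^-distribˡ-+-* 2 (2 * t * 4 * s) (2 * t * s)) ⟩
    2 ^ (2 * t * 4 * s + 2 * t * s)
      ≡⟨ cong (2 ^_) (solve 2 (λ t s → con 2 :* t :* con 4 :* s :+ con 2 :* t :* s := s :* (con 10 :* t)) refl t s) ⟩
    2 ^ (s * (10 * t))
      ≤⟨ ^-monoʳ-≤ 2 (m/n*n≤m l (10 * t)) ⟩
    2 ^ l
      ≤⟨ 2^l≤n ⟩
    n ∎
    where open +-*-Solver

  -- Rounding down in `s` costs at most a factor 2, because `s` is at least 1.
  l≤s*20t : l ≤ s * (20 * t)
  l≤s*20t = begin
    l                     ≤⟨ <⇒≤ (m<suc[m/n]*n l (10 * t)) ⟩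
    suc s * (10 * t)      ≤⟨ *-monoˡ-≤ (10 * t) (+-monoˡ-≤ s 1≤s) ⟩
    (s + s) * (10 * t)    ≡⟨ solve 2 (λ s t → (s :+ s) :* (con 10 :* t) := s :* (con 20 :* t)) refl s t ⟩
    s * (20 * t)          ∎
    where open +-*-Solver

  -- Bits for the cliques, the singles, the neighbourhood of the start and the answer, in this
  -- order.
  b : ℕ
  b = n / s + suc r ^ s + n / l + 1

  b*l≤23nt : b * l ≤ 23 * n * t
  b*l≤23nt = begin
    (n / s + suc r ^ s + n / l + 1) * l
      ≡⟨ solve 4 (λ x y z l → (x :+ y :+ z :+ con 1) :* l := x :* l :+ y :* l :+ z :* l :+ l)
           refl (n / s) (suc r ^ s) (n / l) l ⟩
    n / s * l + suc r ^ s * l + n / l * l + l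
      -- The cliques contribute 20 and each of the other three terms 1, which gives 23.
      ≤⟨ +-mono-≤ (+-mono-≤ (+-mono-≤ n/s*l≤ (≤-trans r^s*l≤n n≤nt)) (≤-trans (m/n*n≤m n l) n≤nt))
                  (≤-trans (<⇒≤ l<n) n≤nt) ⟩
    n * (20 * t) + n * t + n * t + n * t
      ≡⟨ solve 2 (λ n t → n :* (con 20 :* t) :+ n :* t :+ n :* t :+ n :* t := con 23 :* n :* t) refl n t ⟩
    23 * n * t ∎
    where
    open +-*-Solver
    n≤nt : n ≤ n * t
    n≤nt = m≤m*n n t {{>-nonZero 1≤t}}
    n/s*l≤ : n / s * l ≤ n * (20 * t)
    n/s*l≤ = begin
      n / s * l                ≤⟨ *-monoʳ-≤ (n / s) l≤s*20t ⟩
      n / s * (s * (20 * t))   ≡⟨ sym (*-assoc (n / s) s (20 * t)) ⟩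
      n / s * s * (20 * t)     ≤⟨ *-monoˡ-≤ (20 * t) (m/n*n≤m n s) ⟩
      n * (20 * t)             ∎

  mpj-cost : ∀ m → CostAtMost (3 + m) n b
  mpj-cost m =
    let N , N-small , dense = ∃-graph {n} l {r} {R} R-pairs few-sequences
    in costAtMost N N-small r s dense m

  -- With k = 3 + m and x = t/l ≤ 1, the cost is at most 23nx ≤ 23n x^((k-2)/(k-1)). In the (k-1)st
  -- power, k - 2 factors `b` are paired with an `l` each, and the remaining one is bounded by
  -- `23 * n`.
  b-bound : ∀ m → b ^ (2 + m) * l ^ (1 + m) ≤ (23 * n) ^ (2 + m) * ((3 + m) * t) ^ (1 + m)
  b-bound m = begin
    b * b ^ suc m * l ^ suc m
      ≡⟨ trans (*-assoc b _ _) (cong (b *_) (sym (^-distribʳ-* (suc m) b l))) ⟩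
    b * (b * l) ^ suc m
      ≤⟨ *-mono-≤ b≤23n (^-monoˡ-≤ (suc m) (≤-trans b*l≤23nt (*-monoʳ-≤ (23 * n) (m≤n*m t (3 + m))))) ⟩
    23 * n * (23 * n * ((3 + m) * t)) ^ suc m
      ≡⟨ trans (cong (23 * n *_) (^-distribʳ-* (suc m) (23 * n) ((3 + m) * t))) (sym (*-assoc (23 * n) _ _)) ⟩
    23 * n * (23 * n) ^ suc m * ((3 + m) * t) ^ suc m ∎
    where
    b≤23n : b ≤ 23 * n
    b≤23n = *-cancelʳ-≤ b (23 * n) l (≤-trans b*l≤23nt (*-monoʳ-≤ (23 * n) t≤l))

2^e≤n⇒e≤log : ∀ {e n} → 2 ^ e ≤ n → e ≤ ⌊log₂ n ⌋
2^e≤n⇒e≤log {e} 2^e≤n = ≤-trans (≤-reflexive (sym (⌊log₂[2^n]⌋≡n e))) (⌊log₂⌋-mono-≤ 2^e≤n)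

theorem1p3 : Σ ℕ λ c → ∀ (k : ℕ) → 3 ≤ k → Σ ℕ λ N → ∀ (n : ℕ) → N ≤ n →
    Σ ℕ λ b → CostAtMost k n b
    × (b ^ (k ∸ 1) * lg n ^ (k ∸ 2) ≤ (c * n) ^ (k ∸ 1) * (k * lglg n) ^ (k ∸ 2))
theorem1p3 = 23 , λ where
  -- From this threshold on log log n is at least 6, for every k alike.
  (suc (suc (suc m))) (s≤s (s≤s (s≤s z≤n))) → 2 ^ (2 ^ 6) , λ n N≤n →
    let 2^6≤lg = 2^e≤n⇒e≤log {2 ^ 6} N≤n
        open Parameters n (lg n) (lglg n)
          (2^⌊log₂n⌋≤n n (≤-trans (m^n>0 2 (2 ^ 6)) N≤n)) (n<2^[1+⌊log₂n⌋] n)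
          (2^⌊log₂n⌋≤n (lg n) (≤-trans (m^n>0 2 6) 2^6≤lg)) (n<2^[1+⌊log₂n⌋] (lg n))
          (2^e≤n⇒e≤log {6} 2^6≤lg)
    in b , mpj-cost m , b-bound m
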